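{- Let $R=\mathbb{F}_1\times\cdots\times\mathbb{F}_n$, where every $\mathbb{F}_i$ is a field and $n\geq 2$. Then $\mathcal{EG}(R)$ is Class $1$.
   Context: All rings are commutative with identity. $A(R)$ is the set of ideals of $R$ with non-zero annihilator, and $A(R)^*=A(R)\setminus\{(0)\}$. A non-zero ideal $I$ of $R$ is essential, written $I\leq_e R$, if it has non-zero intersection with every non-zero ideal of $R$. The essential annihilating-ideal graph $\mathcal{EG}(R)$ is the simple graph with vertex set $A(R)^*$ in which two distinct vertices $I,J$ are adjacent if and only if $\mathrm{Ann}(IJ)\leq_e R$. For a graph $G$, $\Delta(G)$ is the maximum degree and $\chi'(G)$ the edge chromatic number (smallest number of colors in an edge coloring in which adjacent edges get different colors). $G$ is Class $1$ if $\chi'(G)=\Delta(G)$. -}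

module Defs where

open import Algebra.Bundles using (CommutativeRing)
open import Algebra.Definitions using (Invertible)
open import Data.Fin.Base using (Fin)
open import Data.Nat.Base using (ℕ; _≤_)
open import Data.Product.Base using (∃-syntax; _×_; _,_; proj₁; proj₂)
open import Data.Sum.Base using (_⊎_)
open import Function.Bundles using (Inverse)
open import Level using (Level; _⊔_; suc)
open import Relation.Binary.Bundles using (Setoid)
open import Relation.Binary.Core using (Rel)
open import Relation.Binary.Definitions using (Symmetric; Irreflexive; _Respects₂_)
import Relation.Binary.Construct.On as On
open import Relation.Binary.PropositionalEquality.Core using (_≡_; _≢_)
import Relation.Binary.PropositionalEquality.Properties as ≡
open import Relation.Nullary.Negation.Core using (¬_)
open import Relation.Unary using (Pred; _∈_; _⊆_; _≐_; _∩_)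

------------------------------------------------------------------------
-- Simple graphs

-- Vertices form a setoid: the vertices of interest are ideals, which are
-- predicates identified when they have the same elements.

record SimpleGraph v e a : Set (suc (v ⊔ e ⊔ a)) where
  field
    vertices : Setoid v e
  open Setoid vertices public using (_≈_) renaming (Carrier to Vertex)
  field
    Adj    : Rel Vertex a
    resp   : Adj Respects₂ _≈_
    symm   : Symmetric Adj
    irrefl : Irreflexive _≈_ Adj

module _ {v e a : Level} (G : SimpleGraph v e a) where
  open SimpleGraph G

  neighbours : Vertex → Setoid (v ⊔ a) e
  neighbours u = On.setoid {B = ∃[ w ] Adj u w} vertices proj₁

  HasDegree : Vertex → ℕ → Set (v ⊔ e ⊔ a)
  HasDegree u d = Inverse (neighbours u) (≡.setoid (Fin d))

  -- "Δ(G) = Δ"; in particular every vertex has finite degree.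
  IsMaxDegree : ℕ → Set (v ⊔ e ⊔ a)
  IsMaxDegree Δ = (∃[ u ] HasDegree u Δ)
                × (∀ u → ∃[ d ] HasDegree u d × d ≤ Δ)

  record Edge : Set (v ⊔ a) where
    constructor edge
    field
      {end₁ end₂} : Vertex
      adjacent    : Adj end₁ end₂
  open Edge

  -- An edge is an unordered pair of vertices.
  SameEdge : Rel Edge e
  SameEdge f g = (end₁ f ≈ end₁ g × end₂ f ≈ end₂ g)
               ⊎ (end₁ f ≈ end₂ g × end₂ f ≈ end₁ g)

  _EndOf_ : Vertex → Edge → Set e
  u EndOf f = u ≈ end₁ f ⊎ u ≈ end₂ f

  AdjacentEdges : Rel Edge (v ⊔ e)
  AdjacentEdges f g = ¬ SameEdge f g × (∃[ u ] u EndOf f × u EndOf g)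

  record EdgeColouring (k : ℕ) : Set (v ⊔ e ⊔ a) where
    field
      colour : Edge → Fin k
      cong   : ∀ f g → SameEdge f g → colour f ≡ colour g
      proper : ∀ f g → AdjacentEdges f g → colour f ≢ colour g

  -- "χ′(G) = k"
  IsEdgeChromaticNumber : ℕ → Set (v ⊔ e ⊔ a)
  IsEdgeChromaticNumber k = EdgeColouring k × (∀ m → EdgeColouring m → k ≤ m)

  Class1 : Set (v ⊔ e ⊔ a)
  Class1 = ∃[ Δ ] IsMaxDegree Δ × IsEdgeChromaticNumber Δ

------------------------------------------------------------------------
-- Ideals

module _ {c ℓ : Level} (R : CommutativeRing c ℓ) where
  open CommutativeRing R

  -- The level c ⊔ ℓ of the membership predicate is closed under the
  -- formation of products, annihilators and principal ideals.
  record Ideal : Set (suc (c ⊔ ℓ)) where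
    field
      ⟦_⟧       : Pred Carrier (c ⊔ ℓ)
      respects  : ∀ {x y} → x ≈ y → x ∈ ⟦_⟧ → y ∈ ⟦_⟧
      0∈        : 0# ∈ ⟦_⟧
      +-closed  : ∀ {x y} → x ∈ ⟦_⟧ → y ∈ ⟦_⟧ → x + y ∈ ⟦_⟧
      *-absorbs : ∀ r {x} → x ∈ ⟦_⟧ → r * x ∈ ⟦_⟧
  open Ideal

  idealSetoid : Setoid (suc (c ⊔ ℓ)) (c ⊔ ℓ)
  idealSetoid = record
    { Carrier = Ideal
    ; _≈_     = λ I J → ⟦ I ⟧ ≐ ⟦ J ⟧
    ; isEquivalence = record
      { refl  = (λ x → x) , (λ x → x)
      ; sym   = λ (p , q) → q , p
      ; trans = λ (p , q) (p′ , q′) → (λ x → p′ (p x)) , (λ x → q (q′ x))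
      }
    }

  NonZeroIdeal : Ideal → Set (c ⊔ ℓ)
  NonZeroIdeal I = ¬ (⟦ I ⟧ ≐ (_≈ 0#))

  infixl 7 _∩ᴵ_ _·_

  _∩ᴵ_ : Ideal → Ideal → Ideal
  I ∩ᴵ J = record
    { ⟦_⟧       = ⟦ I ⟧ ∩ ⟦ J ⟧
    ; respects  = λ x≈y (p , q) → respects I x≈y p , respects J x≈y q
    ; 0∈        = 0∈ I , 0∈ J
    ; +-closed  = λ (p , q) (p′ , q′) → +-closed I p p′ , +-closed J q q′
    ; *-absorbs = λ r (p , q) → *-absorbs I r p , *-absorbs J r q
    }

  -- z ∈ I J iff z is a finite sum of terms x * y with x ∈ I and y ∈ J.
  data _∈Product_,_ (z : Carrier) (I J : Ideal) : Set (c ⊔ ℓ) where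
    empty : z ≈ 0# → z ∈Product I , J
    term  : ∀ {x y w} → x ∈ ⟦ I ⟧ → y ∈ ⟦ J ⟧ → w ∈Product I , J →
            z ≈ x * y + w → z ∈Product I , J

  private
    variable
      I J I′ J′ : Ideal

    product-resp : ∀ {z z′} → z ≈ z′ → z ∈Product I , J → z′ ∈Product I , J
    product-resp z≈z′ (empty z≈0)      = empty (trans (sym z≈z′) z≈0)
    product-resp z≈z′ (term p q r z≈t) = term p q r (trans (sym z≈z′) z≈t)

    product-+ : ∀ {z z′} → z ∈Product I , J → z′ ∈Product I , J →
                (z + z′) ∈Product I , J
    product-+ (empty z≈0) s =
      product-resp (sym (trans (+-congʳ z≈0) (+-identityˡ _))) s
    product-+ (term p q r z≈t) s =
      term p q (product-+ r s) (trans (+-congʳ z≈t) (+-assoc _ _ _))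

    product-* : ∀ r {z} → z ∈Product I , J → (r * z) ∈Product I , J
    product-* r (empty z≈0) = empty (trans (*-congˡ z≈0) (zeroʳ r))
    product-* {I = I} r (term p q s z≈t) =
      term (*-absorbs I r p) q (product-* r s)
        (trans (*-congˡ z≈t) (trans (distribˡ r _ _) (+-congʳ (sym (*-assoc r _ _)))))

    product-mono : ⟦ I ⟧ ⊆ ⟦ I′ ⟧ → ⟦ J ⟧ ⊆ ⟦ J′ ⟧ →
                   ∀ {z} → z ∈Product I , J → z ∈Product I′ , J′
    product-mono f g (empty z≈0)      = empty z≈0
    product-mono f g (term p q r z≈t) = term (f p) (g q) (product-mono f g r) z≈t

    product-swap : ∀ {z} → z ∈Product I , J → z ∈Product J , I
    product-swap (empty z≈0)      = empty z≈0
    product-swap (term p q r z≈t) =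
      term q p (product-swap r) (trans z≈t (+-congʳ (*-comm _ _)))

  _·_ : Ideal → Ideal → Ideal
  I · J = record
    { ⟦_⟧       = λ z → z ∈Product I , J
    ; respects  = product-resp
    ; 0∈        = empty refl
    ; +-closed  = product-+
    ; *-absorbs = product-*
    }

  Ann : Ideal → Ideal
  Ann I = record
    { ⟦_⟧       = λ r → ∀ x → x ∈ ⟦ I ⟧ → r * x ≈ 0#
    ; respects  = λ r≈s p x x∈I → trans (*-congʳ (sym r≈s)) (p x x∈I)
    ; 0∈        = λ x _ → zeroˡ x
    ; +-closed  = λ p q x x∈I → trans (distribʳ x _ _)
                    (trans (+-cong (p x x∈I) (q x x∈I)) (+-identityˡ 0#))
    ; *-absorbs = λ r p x x∈I → trans (*-assoc r _ x)
                    (trans (*-congˡ (p x x∈I)) (zeroʳ r))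
    }

  Essential : Ideal → Set (suc (c ⊔ ℓ))
  Essential I = NonZeroIdeal I × (∀ J → NonZeroIdeal J → NonZeroIdeal (I ∩ᴵ J))

  private
    NonZero-mono : ⟦ I ⟧ ⊆ ⟦ J ⟧ → NonZeroIdeal I → NonZeroIdeal J
    NonZero-mono {I = I} I⊆J I≠0 J≐0 =
      I≠0 ((λ x∈I → proj₁ J≐0 (I⊆J x∈I)) , (λ x≈0 → respects I (sym x≈0) (0∈ I)))

    Essential-mono : ⟦ I ⟧ ⊆ ⟦ J ⟧ → Essential I → Essential J
    Essential-mono {I = I} {J = J} I⊆J (I≠0 , ess) =
      NonZero-mono {I = I} {J = J} I⊆J I≠0 ,
      λ K K≠0 → NonZero-mono {I = I ∩ᴵ K} {J = J ∩ᴵ K}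
                  (λ (p , q) → I⊆J p , q) (ess K K≠0)

    Ann-anti : ⟦ J ⟧ ⊆ ⟦ I ⟧ → ⟦ Ann I ⟧ ⊆ ⟦ Ann J ⟧
    Ann-anti J⊆I p x x∈J = p x (J⊆I x∈J)

    EssAnn-anti : (∀ {z} → z ∈Product I′ , J′ → z ∈Product I , J) →
                  Essential (Ann (I · J)) → Essential (Ann (I′ · J′))
    EssAnn-anti {I′ = I′} {J′ = J′} {I = I} {J = J} f =
      Essential-mono {I = Ann (I · J)} {J = Ann (I′ · J′)}
        (Ann-anti {J = I′ · J′} {I = I · J} f)

------------------------------------------------------------------------
-- The essential annihilating-ideal graph

  record AnnihilatingIdeal : Set (suc (c ⊔ ℓ)) where
    field
      ideal       : Ideal
      nonZero     : NonZeroIdeal ideal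
      nonZero-Ann : NonZeroIdeal (Ann ideal)
  open AnnihilatingIdeal

  EG : SimpleGraph (suc (c ⊔ ℓ)) (c ⊔ ℓ) (suc (c ⊔ ℓ))
  EG = record
    { vertices = vs
    ; Adj      = λ I J → ¬ (I ≈ᵛ J) × Essential (Ann (ideal I · ideal J))
    ; resp     =
        (λ {I} {J} {J′} J≈J′ (I≉J , ess) →
          (λ I≈J′ → I≉J (V.trans {I} {J′} {J} I≈J′ (V.sym {J} {J′} J≈J′))) ,
          EssAnn-anti {I′ = ideal I} {J′ = ideal J′} {I = ideal I} {J = ideal J}
            (product-mono {I = ideal I} {I′ = ideal I} {J = ideal J′} {J′ = ideal J}
              (λ x → x) (proj₂ J≈J′))
            ess) ,
        (λ {J} {I} {I′} I≈I′ (I≉J , ess) →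
          (λ I′≈J → I≉J (V.trans {I} {I′} {J} I≈I′ I′≈J)) ,
          EssAnn-anti {I′ = ideal I′} {J′ = ideal J} {I = ideal I} {J = ideal J}
            (product-mono {I = ideal I′} {I′ = ideal I} {J = ideal J} {J′ = ideal J}
              (proj₂ I≈I′) (λ x → x))
            ess)
    ; symm     = λ {I} {J} (I≉J , ess) →
        (λ J≈I → I≉J (V.sym {J} {I} J≈I)) ,
        EssAnn-anti {I′ = ideal J} {J′ = ideal I} {I = ideal I} {J = ideal J}
          product-swap ess
    ; irrefl   = λ I≈J (I≉J , _) → I≉J I≈J
    }
    where
    vs : Setoid (suc (c ⊔ ℓ)) (c ⊔ ℓ)
    vs = On.setoid idealSetoid ideal
    module V = Setoid vs
    open V using () renaming (_≈_ to _≈ᵛ_)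

------------------------------------------------------------------------
-- Fields and products of rings

-- The classical notion: the library's HeytingField instead carries an
-- apartness relation as extra structure.
record Field c ℓ : Set (suc (c ⊔ ℓ)) where
  field
    commutativeRing : CommutativeRing c ℓ
  open CommutativeRing commutativeRing public
  field
    1≉0        : ¬ (1# ≈ 0#)
    invertible : ∀ x → ¬ (x ≈ 0#) → Invertible _≈_ 1# _*_ x

Π : ∀ {c ℓ n} → (Fin n → CommutativeRing c ℓ) → CommutativeRing c ℓ
Π F = record
  { Carrier = ∀ i → Carrier (F i)
  ; _≈_     = λ x y → ∀ i → _≈_ (F i) (x i) (y i)
  ; _+_     = λ x y i → _+_ (F i) (x i) (y i)
  ; _*_     = λ x y i → _*_ (F i) (x i) (y i)
  ; -_      = λ x i → -_ (F i) (x i)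
  ; 0#      = λ i → 0# (F i)
  ; 1#      = λ i → 1# (F i)
  ; isCommutativeRing = record
    { isRing = record
      { +-isAbelianGroup = record
        { isGroup = record
          { isMonoid = record
            { isSemigroup = record
              { isMagma = record
                { isEquivalence = record
                  { refl  = λ i → refl (F i)
                  ; sym   = λ p i → sym (F i) (p i)
                  ; trans = λ p q i → trans (F i) (p i) (q i)
                  }
                ; ∙-cong = λ p q i → +-cong (F i) (p i) (q i)
                }
              ; assoc = λ x y z i → +-assoc (F i) (x i) (y i) (z i)
              }
            ; identity = (λ x i → +-identityˡ (F i) (x i))
                       , (λ x i → +-identityʳ (F i) (x i))
            }
          ; inverse = (λ x i → -‿inverseˡ (F i) (x i))
                    , (λ x i → -‿inverseʳ (F i) (x i))
          ; ⁻¹-cong = λ p i → -‿cong (F i) (p i)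
          }
        ; comm = λ x y i → +-comm (F i) (x i) (y i)
        }
      ; *-cong = λ p q i → *-cong (F i) (p i) (q i)
      ; *-assoc = λ x y z i → *-assoc (F i) (x i) (y i) (z i)
      ; *-identity = (λ x i → *-identityˡ (F i) (x i))
                   , (λ x i → *-identityʳ (F i) (x i))
      ; distrib = (λ x y z i → distribˡ (F i) (x i) (y i) (z i))
                , (λ x y z i → distribʳ (F i) (x i) (y i) (z i))
      }
    ; *-comm = λ x y i → *-comm (F i) (x i) (y i)
    }
  }
  where open CommutativeRing

{-# OPTIONS --safe #-}

-- An ideal of a product of n fields is determined by its support, a subset of
-- {0, …, n − 1}, and EG is the graph on the nonempty proper subsets in which
-- S and T are adjacent iff they are disjoint.  Colour the edge {S, T} by the
-- pair {U, ∁ U}, where U = S ∪ T unless S ∪ T is everything, and then U = S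
-- (so that T = ∁ U).  If {S, T} and {S, T′} get the same colour with T ≠ T′,
-- then one of S, T, T′ would be empty.  The colours, with each pair represented
-- by its member that avoids 0, are precisely the neighbours of {0}, and no
-- vertex has a larger degree than the number of colours, since the edges at a
-- vertex are all coloured differently.
module Submission where

open import Defs
open import Algebra.Bundles using (CommutativeRing)
import Algebra.Lattice.Properties.BooleanAlgebra as BooleanAlgebraProperties
open import Axiom.ExcludedMiddle using (ExcludedMiddle)
open import Data.Empty using (⊥-elim)
open import Data.Fin.Base using (Fin; zero; suc; join; splitAt)
open import Data.Fin.Properties using (_≟_; injective⇒≤; join-splitAt; splitAt-join)
open import Data.Fin.Subset
  using (Subset; inside; outside; _∈_; _∉_; _⊆_; _∪_; _∩_; ∁; ⁅_⁆; Nonempty; Empty)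
open import Data.Fin.Subset.Properties
  using ( _∈?_; nonempty?; ⊆-antisym; ∪-comm; ∪-∩-booleanAlgebra
        ; x∈⁅x⁆; x∈⁅y⁆⇒x≡y; x∈p∩q⁺; x∈p∩q⁻; x∈p∪q⁺; x∈p∪q⁻
        ; x∈p⇒x∉∁p; x∈∁p⇒x∉p; x∉∁p⇒x∈p; x∉p⇒x∈∁p)
open import Data.List.Base using (List; []; _∷_; allFin)
import Data.List.Membership.Propositional as List
open import Data.List.Membership.Propositional.Properties using (∈-allFin)
open import Data.List.Relation.Unary.Any using (here; there)
open import Data.Nat.Base using (ℕ; _+_; _≤_; s≤s; z≤n)
open import Data.Product.Base using (∃; ∃-syntax; _×_; _,_; proj₁; proj₂)
open import Data.Sum.Base using (_⊎_; inj₁; inj₂; [_,_]′)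
open import Data.Vec.Base using ([]; _∷_; tabulate; tail; there)
open import Data.Vec.Properties using ([]=⇒lookup; lookup⇒[]=; lookup∘tabulate)
open import Function.Base using (_∘_)
open import Function.Bundles using (Inverse)
open import Level using (Level; _⊔_; Lift; lift; lower)
open import Relation.Binary.Bundles using (Setoid)
import Relation.Binary.Construct.On as On
open import Relation.Binary.PropositionalEquality
  using (_≡_; _≢_; refl; sym; trans; cong; subst; setoid)
open import Relation.Nullary
  using (Dec; does; yes; no; ¬_; ¬?; contradiction; decidable-stable; _×-dec_)
open import Relation.Nullary.Decidable using (map′; dec-true)
open import Relation.Unary using (Pred; Decidable)

-- Finite types of subsets

-- This comment concerns the encoding: only the underlying subsets are compared, so different proofs
-- of `P` do not create different elements, just as `neighbours` compares vertices and ignores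
-- adjacency proofs.
Subsets : ∀ {n p} → Pred (Subset n) p → Setoid p _
Subsets {n} P = On.setoid {B = ∃ P} (setoid (Subset n)) proj₁

-- Induction on `n`: the subsets containing the first point are numbered first, then those omitting
-- it. The same numbering serves both for degrees and for colours.
enumerate : ∀ {n p} {P : Pred (Subset n) p} → Decidable P →
            ∃[ d ] Inverse (Subsets P) (setoid (Fin d))
enumerate {ℕ.zero} P? with P? []
... | yes p = 1 , record
  { to        = λ _ → zero
  ; from      = λ _ → [] , p
  ; to-cong   = λ _ → refl
  ; from-cong = λ _ → refl
  ; inverse   = (λ { {zero} _ → refl }) , (λ { {[] , _} _ → refl })
  }
... | no ¬p = 0 , record
  { to        = λ { ([] , p) → contradiction p ¬p }
  ; from      = λ ()
  ; to-cong   = λ { {[] , p} → contradiction p ¬p }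
  ; from-cong = λ { {()} }
  ; inverse   = (λ { {()} }) , (λ { {[] , p} → contradiction p ¬p })
  }
enumerate {ℕ.suc n} {P = P} P? with enumerate (P? ∘ (inside ∷_)) | enumerate (P? ∘ (outside ∷_))
... | a , A | b , B = a + b , record
  { to        = to
  ; from      = from
  ; to-cong   = to-cong
  ; from-cong = λ { refl → refl }
  ; inverse   = (λ {k} eq → trans (to-cong eq) (to∘from k))
              , (λ { {T} refl → from∘to T })
  }
  where
  module A = Inverse A
  module B = Inverse B

  to : ∃ P → Fin (a + b)
  to (inside  ∷ T , p) = join a b (inj₁ (A.to (T , p)))
  to (outside ∷ T , p) = join a b (inj₂ (B.to (T , p)))

  prepend : Fin a ⊎ Fin b → ∃ P
  prepend (inj₁ k) = let T , p = A.from k in inside  ∷ T , p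
  prepend (inj₂ k) = let T , p = B.from k in outside ∷ T , p

  from : Fin (a + b) → ∃ P
  from k = prepend (splitAt a k)

  to-cong : ∀ {S T : ∃ P} → proj₁ S ≡ proj₁ T → to S ≡ to T
  to-cong {inside  ∷ _ , _} {_ , _} refl = cong (join a b ∘ inj₁) (A.to-cong refl)
  to-cong {outside ∷ _ , _} {_ , _} refl = cong (join a b ∘ inj₂) (B.to-cong refl)

  to∘prepend : ∀ s → to (prepend s) ≡ join a b s
  to∘prepend (inj₁ k) = cong (join a b ∘ inj₁) (A.strictlyInverseˡ k)
  to∘prepend (inj₂ k) = cong (join a b ∘ inj₂) (B.strictlyInverseˡ k)

  to∘from : ∀ k → to (from k) ≡ k
  to∘from k = trans (to∘prepend (splitAt a k)) (join-splitAt a b k)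

  from∘to : ∀ T → proj₁ (from (to T)) ≡ proj₁ T
  from∘to (inside  ∷ T , p) = trans (cong (proj₁ ∘ prepend) (splitAt-join a b (inj₁ _)))
                                    (cong (inside ∷_) (A.strictlyInverseʳ (T , p)))
  from∘to (outside ∷ T , p) = trans (cong (proj₁ ∘ prepend) (splitAt-join a b (inj₂ _)))
                                    (cong (outside ∷_) (B.strictlyInverseʳ (T , p)))

-- Degrees and edge colourings

module _ {v e a : Level} (G : SimpleGraph v e a) where
  open SimpleGraph G
  private module V = Setoid vertices

  degree≤colours : ∀ {u d k} → HasDegree G u d → EdgeColouring G k → d ≤ k
  degree≤colours {u} {d} {k} N C = injective⇒≤ star-injective
    where
    module N = Inverse N
    open EdgeColouring C

    spoke : Fin d → Edge G
    spoke i = edge (proj₂ (N.from i))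

    distinct : ∀ {i j} → i ≢ j → ¬ SameEdge G (spoke i) (spoke j)
    distinct {i} {j} i≢j (inj₁ (_ , wᵢ≈wⱼ)) =
      i≢j (trans (sym (N.strictlyInverseˡ i))
          (trans (N.to-cong {N.from i} {N.from j} wᵢ≈wⱼ) (N.strictlyInverseˡ j)))
    -- Two spokes matching in opposite directions would make `u` equal to its own neighbour.
    distinct {i} {j} _ (inj₂ (u≈wⱼ , _)) = irrefl u≈wⱼ (proj₂ (N.from j))

    star-injective : ∀ {i j} → colour (spoke i) ≡ colour (spoke j) → i ≡ j
    star-injective {i} {j} eq = decidable-stable (i ≟ j) λ i≢j →
      proper (spoke i) (spoke j)
        (distinct i≢j , u , inj₁ V.refl , inj₁ V.refl) eq

  -- The colouring with `k` colours bounds every degree by `k`, and the vertex `u` of degree `k`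
  -- forces every colouring to use at least `k` colours.
  degree-many-colours⇒Class1 : ∀ {u k} → HasDegree G u k → (∀ w → ∃[ d ] HasDegree G w d) →
                               EdgeColouring G k → Class1 G
  degree-many-colours⇒Class1 {u} {k} N degree C =
    k , ((u , N) , λ w → let d , M = degree w in d , M , degree≤colours M C)
      , C , λ m C′ → degree≤colours N C′

-- Disjoint subsets

Disjoint : ∀ {n} → Subset n → Subset n → Set
Disjoint S T = Empty (S ∩ T)

module _ {n : ℕ} where

  open BooleanAlgebraProperties (∪-∩-booleanAlgebra n)
    using () renaming (¬-involutive to ∁-involutive) public

module _ {n : ℕ} {S T : Subset n} where

  Disjoint⇒∉ : Disjoint S T → ∀ {i} → i ∈ S → i ∉ T
  Disjoint⇒∉ S∩T=∅ i∈S i∈T = S∩T=∅ (_ , x∈p∩q⁺ (i∈S , i∈T))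

  ∉⇒Disjoint : (∀ {i} → i ∈ S → i ∉ T) → Disjoint S T
  ∉⇒Disjoint f (i , i∈S∩T) = let i∈S , i∈T = x∈p∩q⁻ S T i∈S∩T in f i∈S i∈T

  Disjoint-sym : Disjoint S T → Disjoint T S
  Disjoint-sym S∩T=∅ (i , i∈T∩S) =
    let i∈T , i∈S = x∈p∩q⁻ T S i∈T∩S in Disjoint⇒∉ S∩T=∅ i∈S i∈T

  Disjoint⇒Nonempty-∁ : Disjoint S T → Nonempty T → Nonempty (∁ S)
  Disjoint⇒Nonempty-∁ S∩T=∅ (i , i∈T) = i , x∉p⇒x∈∁p λ i∈S → Disjoint⇒∉ S∩T=∅ i∈S i∈T

  Disjoint∧cover⇒≡∁ : Disjoint S T → Empty (∁ (S ∪ T)) → T ≡ ∁ S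
  Disjoint∧cover⇒≡∁ S∩T=∅ cover = ⊆-antisym
    (λ i∈T → x∉p⇒x∈∁p λ i∈S → Disjoint⇒∉ S∩T=∅ i∈S i∈T)
    (λ {i} i∈∁S → [ (λ i∈S → contradiction i∈∁S (x∈p⇒x∉∁p i∈S)) , (λ i∈T → i∈T) ]′
      (x∈p∪q⁻ S T (x∉∁p⇒x∈p λ i∈ → cover (i , i∈))))

∪-cancelˡ-⊆ : ∀ {n} {S T T′ : Subset n} → Disjoint S T → S ∪ T ≡ S ∪ T′ → T ⊆ T′
∪-cancelˡ-⊆ {S = S} {T′ = T′} S∩T=∅ eq {i} i∈T =
  [ (λ i∈S → contradiction i∈T (Disjoint⇒∉ S∩T=∅ i∈S)) , (λ i∈T′ → i∈T′) ]′
    (x∈p∪q⁻ S T′ (subst (i ∈_) eq (x∈p∪q⁺ (inj₂ i∈T))))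

-- Complementary pairs of subsets and the colour of a disjoint pair

representative : ∀ {m} → Subset (ℕ.suc m) → Subset (ℕ.suc m)
representative (inside  ∷ U) = outside ∷ ∁ U
representative (outside ∷ U) = outside ∷ U

module _ {m : ℕ} where

  0∉representative : ∀ (U : Subset (ℕ.suc m)) → zero ∉ representative U
  0∉representative (inside  ∷ U) ()
  0∉representative (outside ∷ U) ()

  representative-∁ : ∀ (U : Subset (ℕ.suc m)) → representative (∁ U) ≡ representative U
  representative-∁ (inside  ∷ U) = refl
  representative-∁ (outside ∷ U) = cong (outside ∷_) (∁-involutive U)

  representative-nonempty : ∀ (U : Subset (ℕ.suc m)) → Nonempty U → Nonempty (∁ U) →
                            Nonempty (representative U)
  representative-nonempty (inside  ∷ U) _  ∁U = ∁U
  representative-nonempty (outside ∷ U) ne _  = ne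

  representative-injective : ∀ (U V : Subset (ℕ.suc m)) → representative U ≡ representative V →
                             U ≡ V ⊎ U ≡ ∁ V
  representative-injective (outside ∷ U) (outside ∷ V) refl = inj₁ refl
  representative-injective (outside ∷ U) (inside  ∷ V) refl = inj₂ refl
  representative-injective (inside  ∷ U) (outside ∷ V) refl =
    inj₂ (cong (inside ∷_) (sym (∁-involutive U)))
  -- Both sets contain 0, so `eq` compares the complements of their tails; complementing again
  -- recovers the tails.
  representative-injective (inside  ∷ U) (inside  ∷ V) eq   =
    inj₁ (cong (inside ∷_) (trans (sym (∁-involutive U))
      (trans (cong ∁ (cong tail eq)) (∁-involutive V))))

  -- The fallback `S` serves the case where `U = S ∪ T` is everything: the pair of `U` and its
  -- complement would have the empty set as representative, which is no colour.
  properOr : Subset (ℕ.suc m) → Subset (ℕ.suc m) → Subset (ℕ.suc m)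
  properOr U S with nonempty? (∁ U)
  ... | yes _ = U
  ... | no  _ = S

  pairColour : Subset (ℕ.suc m) → Subset (ℕ.suc m) → Subset (ℕ.suc m)
  pairColour S T = representative (properOr (S ∪ T) S)

  module _ {S T : Subset (ℕ.suc m)} (S∩T=∅ : Disjoint S T) where

    pairColour-nonempty : Nonempty S → Nonempty T → Nonempty (pairColour S T)
    pairColour-nonempty (i , i∈S) T≠∅ with nonempty? (∁ (S ∪ T))
    ... | yes ∁≠∅ = representative-nonempty (S ∪ T) (i , x∈p∪q⁺ (inj₁ i∈S)) ∁≠∅
    ... | no  _   = representative-nonempty S (i , i∈S) (Disjoint⇒Nonempty-∁ S∩T=∅ T≠∅)

    -- The union is symmetric. When it is everything, the two fallbacks `S` and `T` are
    -- complementary and hence have the same representative.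
    pairColour-comm : pairColour S T ≡ pairColour T S
    pairColour-comm rewrite ∪-comm T S with nonempty? (∁ (S ∪ T))
    ... | yes _     = refl
    ... | no  cover rewrite Disjoint∧cover⇒≡∁ S∩T=∅ cover = sym (representative-∁ S)

  -- `S ≡ S ∪ T` would put the points of `T` into `S`, and `S ≡ ∁ (S ∪ T)` would leave `S` empty.
  -- This separates colours of the fallback kind from those given by a proper union.
  representative-∪-≢ : ∀ {S T : Subset (ℕ.suc m)} → Nonempty S → Nonempty T → Disjoint S T →
                       representative S ≢ representative (S ∪ T)
  representative-∪-≢ {S} {T} (i , i∈S) (j , j∈T) S∩T=∅ eq
    with representative-injective S (S ∪ T) eq
  ... | inj₁ S≡S∪T = Disjoint⇒∉ S∩T=∅ (subst (j ∈_) (sym S≡S∪T) (x∈p∪q⁺ (inj₂ j∈T))) j∈T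
  ... | inj₂ S≡∁   = x∈∁p⇒x∉p (subst (i ∈_) S≡∁ i∈S) (x∈p∪q⁺ (inj₁ i∈S))

  -- If both unions are everything, `T` and `T′` are both the complement of `S`; one full and one
  -- proper union never share a colour. Two proper unions are equal, and then `S` cancels, or
  -- complementary, which is impossible since both contain `S`.
  pairColour-injective : ∀ {S T T′ : Subset (ℕ.suc m)} → Nonempty S → Nonempty T → Nonempty T′ →
                         Disjoint S T → Disjoint S T′ →
                         pairColour S T ≡ pairColour S T′ → T ≡ T′
  pairColour-injective {S} {T} {T′} S≠∅@(i , i∈S) T≠∅ T′≠∅ S∩T=∅ S∩T′=∅ eq
    with nonempty? (∁ (S ∪ T)) | nonempty? (∁ (S ∪ T′))
  ... | no c  | no c′ = trans (Disjoint∧cover⇒≡∁ S∩T=∅ c) (sym (Disjoint∧cover⇒≡∁ S∩T′=∅ c′))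
  ... | no _  | yes _ = contradiction eq (representative-∪-≢ S≠∅ T′≠∅ S∩T′=∅)
  ... | yes _ | no _  = contradiction (sym eq) (representative-∪-≢ S≠∅ T≠∅ S∩T=∅)
  ... | yes _ | yes _ with representative-injective (S ∪ T) (S ∪ T′) eq
  ...   | inj₁ ≡∪ = ⊆-antisym (∪-cancelˡ-⊆ S∩T=∅ ≡∪) (∪-cancelˡ-⊆ S∩T′=∅ (sym ≡∪))
  ...   | inj₂ ≡∁ = contradiction (x∈p∪q⁺ (inj₁ i∈S))
                      (x∈∁p⇒x∉p (subst (i ∈_) ≡∁ (x∈p∪q⁺ (inj₁ i∈S))))

-- The disjointness graph on the nonempty proper subsets

-- All that the graph-theoretic argument needs to know about the ring: supports determine vertices,
-- every nonempty proper subset occurs as a support, and adjacency is disjointness.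
record IsDisjointnessGraph {v e a} (n : ℕ) (G : SimpleGraph v e a) : Set (v ⊔ e ⊔ a) where
  open SimpleGraph G
  field
    support           : Vertex → Subset n
    support-cong      : ∀ {u w} → u ≈ w → support u ≡ support w
    support-injective : ∀ {u w} → support u ≡ support w → u ≈ w
    support-nonempty  : ∀ u → Nonempty (support u)
    vertex            : ∀ S → Nonempty S → Nonempty (∁ S) → Vertex
    support-vertex    : ∀ S S≠∅ ∁S≠∅ → support (vertex S S≠∅ ∁S≠∅) ≡ S
    Adj⇒Disjoint      : ∀ {u w} → Adj u w → Disjoint (support u) (support w)
    Disjoint⇒Adj      : ∀ {u w} → Disjoint (support u) (support w) → Adj u w

-- Degrees and the edge colouring of the disjointness graph

module _ {v e a m} {G : SimpleGraph v e a} (D : IsDisjointnessGraph (ℕ.suc (ℕ.suc m)) G) where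
  open SimpleGraph G
  open IsDisjointnessGraph D
  private module V = Setoid vertices

  NeighbourSupport : Vertex → Pred (Subset (ℕ.suc (ℕ.suc m))) _
  NeighbourSupport u T = Nonempty T × Disjoint (support u) T

  neighbourSupport? : ∀ u → Decidable (NeighbourSupport u)
  neighbourSupport? u T = nonempty? T ×-dec ¬? (nonempty? (support u ∩ T))

  neighbours↔subsets : ∀ u → Inverse (neighbours G u) (Subsets (NeighbourSupport u))
  neighbours↔subsets u = record
    { to        = λ (w , u~w) → support w , support-nonempty w , Adj⇒Disjoint u~w
    ; from      = λ T → neighbour T , Disjoint⇒Adj
        (subst (Disjoint (support u)) (sym (support-neighbour T)) (proj₂ (proj₂ T)))
    ; to-cong   = support-cong
    ; from-cong = λ {S} {T} S≡T → support-injective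
        (trans (support-neighbour S) (trans S≡T (sym (support-neighbour T))))
    ; inverse   =
        (λ {T} w≈ → trans (support-cong w≈) (support-neighbour T)) ,
        (λ {_} {T} T≡ → support-injective (trans (support-neighbour T) T≡))
    }
    where
    neighbour : ∃ (NeighbourSupport u) → Vertex
    neighbour (T , T≠∅ , u∩T=∅) =
      -- `T` is proper because it misses the nonempty support of `u`.
      vertex T T≠∅ (Disjoint⇒Nonempty-∁ (Disjoint-sym u∩T=∅) (support-nonempty u))

    support-neighbour : ∀ T → support (neighbour T) ≡ proj₁ T
    support-neighbour (T , T≠∅ , _) = support-vertex T T≠∅ _

  degree : ∀ u → ∃[ d ] HasDegree G u d
  degree u = let d , E = enumerate (neighbourSupport? u) in
    d , inverse (neighbours↔subsets u) E
    where open import Function.Construct.Composition using (inverse)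

  0-vertex : Vertex
  -- The point 1 shows that the singleton of 0 is proper; here it matters that there are at least
  -- two indices.
  0-vertex = vertex ⁅ zero ⁆ (zero , x∈⁅x⁆ zero) (suc zero , x∉p⇒x∈∁p λ { (there ()) })

  -- The colours are numbered by the same enumeration that computes the degree of `0-vertex`, so the
  -- number of colours equals that degree definitionally.
  palette : ∃[ d ] Inverse (Subsets (NeighbourSupport 0-vertex)) (setoid (Fin d))
  palette = enumerate (neighbourSupport? 0-vertex)

  colouring : EdgeColouring G (proj₁ palette)
  colouring = record
    { colour = λ f → P.to (swatch f)
    ; cong   = λ f g f≈g → P.to-cong {swatch f} {swatch g} (swatch-cong f g f≈g)
    -- Equality of colour numbers is carried back through the enumeration to equality of the
    -- underlying subsets; a shared end then makes the two edges the same.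
    ; proper = λ f g (f≉g , u , u∈f , u∈g) eq → f≉g (proper f g u∈f u∈g
        (trans (sym (P.strictlyInverseʳ (swatch f)))
               (trans (P.from-cong eq) (P.strictlyInverseʳ (swatch g)))))
    }
    where
    open Edge
    module P = Inverse (proj₂ palette)

    disjoint : ∀ f → Disjoint (support (end₁ f)) (support (end₂ f))
    disjoint f = Adj⇒Disjoint (adjacent f)

    edgeColour : Edge G → Subset (ℕ.suc (ℕ.suc m))
    edgeColour f = pairColour (support (end₁ f)) (support (end₂ f))

    swatch : Edge G → ∃ (NeighbourSupport 0-vertex)
    swatch f = edgeColour f
      , pairColour-nonempty (disjoint f) (support-nonempty _) (support-nonempty _)
      -- The support of `0-vertex` contains only `zero`, which no representative contains.
      , ∉⇒Disjoint λ {i} i∈0 i∈c → 0∉representative (properOr (support (end₁ f) ∪ support (end₂ f)) (support (end₁ f)))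
          (subst (_∈ edgeColour f)
            (x∈⁅y⁆⇒x≡y zero (subst (i ∈_) (support-vertex ⁅ zero ⁆ _ _) i∈0)) i∈c)

    -- Reversal reduces the four ways in which two edges can share an end to a shared first end, the
    -- case treated by `other-end`.
    reverse : Edge G → Edge G
    reverse f = edge (symm (adjacent f))

    reverse-colour : ∀ f → edgeColour (reverse f) ≡ edgeColour f
    reverse-colour f = sym (pairColour-comm (disjoint f))

    parallel-cong : ∀ f g → end₁ f ≈ end₁ g → end₂ f ≈ end₂ g → edgeColour f ≡ edgeColour g
    parallel-cong f g p q rewrite support-cong p | support-cong q = refl

    swatch-cong : ∀ f g → SameEdge G f g → edgeColour f ≡ edgeColour g
    swatch-cong f g (inj₁ (p , q)) = parallel-cong f g p q
    swatch-cong f g (inj₂ (p , q)) = trans (parallel-cong f (reverse g) p q) (reverse-colour g)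

    other-end : ∀ f g → end₁ f ≈ end₁ g → edgeColour f ≡ edgeColour g → end₂ f ≈ end₂ g
    other-end f g p eq = support-injective
      (pairColour-injective (support-nonempty _) (support-nonempty _) (support-nonempty _)
        (disjoint f) (subst (λ S → Disjoint S (support (end₂ g))) (sym (support-cong p)) (disjoint g))
        (trans eq (cong (λ S → pairColour S (support (end₂ g))) (sym (support-cong p)))))

    proper : ∀ f g {u} → _EndOf_ G u f → _EndOf_ G u g →
             edgeColour f ≡ edgeColour g → SameEdge G f g
    proper f g (inj₁ p) (inj₁ q) eq =
      let r = V.trans (V.sym p) q in inj₁ (r , other-end f g r eq)
    proper f g (inj₁ p) (inj₂ q) eq =
      let r = V.trans (V.sym p) q in
      inj₂ (r , other-end f (reverse g) r (trans eq (sym (reverse-colour g))))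
    proper f g (inj₂ p) (inj₁ q) eq =
      let r = V.trans (V.sym p) q in
      inj₂ (other-end (reverse f) g r (trans (reverse-colour f) eq) , r)
    proper f g (inj₂ p) (inj₂ q) eq =
      let r = V.trans (V.sym p) q in
      inj₁ (other-end (reverse f) (reverse g) r
              (trans (reverse-colour f) (trans eq (sym (reverse-colour g)))) , r)

  disjointness⇒Class1 : Class1 G
  disjointness⇒Class1 =
    degree-many-colours⇒Class1 G (proj₂ (degree 0-vertex)) degree colouring

-- Ideals of a product of fields

module _ {c ℓ : Level} (em : ExcludedMiddle (c ⊔ ℓ)) {n : ℕ} (F : Fin n → Field c ℓ) where

  private
    module F i = Field (F i)
    R = Π (λ i → Field.commutativeRing (F i))
    module R = CommutativeRing R

  open Ideal {R = R}

  -- Coordinate vectors and idempotents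

  single : ∀ i → F.Carrier i → R.Carrier
  single i a j with i ≟ j
  ... | yes refl = a
  ... | no  _    = F.0# j

  single-≡ : ∀ i a → F._≈_ i (single i a i) a
  single-≡ i a with i ≟ i
  ... | yes refl = F.refl i
  ... | no  i≢i  = contradiction refl i≢i

  single-≢ : ∀ {i j} a → i ≢ j → F._≈_ j (single i a j) (F.0# j)
  single-≢ {i} {j} a i≢j with i ≟ j
  ... | yes i≡j = contradiction i≡j i≢j
  ... | no  _   = F.refl j

  single-cong : ∀ i {a b} → F._≈_ i a b → single i a R.≈ single i b
  single-cong i a≈b j with i ≟ j
  ... | yes refl = a≈b
  ... | no  _    = F.refl j

  single-* : ∀ i a x → (single i a R.* x) R.≈ single i (F._*_ i a (x i))
  single-* i a x j with i ≟ j
  ... | yes refl = F.refl i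
  ... | no  _    = F.zeroˡ j (x j)

  single-0 : ∀ i → single i (F.0# i) R.≈ R.0#
  single-0 i j with i ≟ j
  ... | yes refl = F.refl i
  ... | no  _    = F.refl j

  -- Together with `single` this peels one coordinate off a vector, for the induction over
  -- coordinates in `supported-on⇒∈`.
  erase : Fin n → R.Carrier → R.Carrier
  erase i x j with i ≟ j
  ... | yes _ = F.0# j
  ... | no  _ = x j

  single+erase : ∀ i x → (single i (x i) R.+ erase i x) R.≈ x
  single+erase i x j with i ≟ j
  ... | yes refl = F.+-identityʳ i (x i)
  ... | no  _    = F.+-identityˡ j (x j)

  erase-vanishes : ∀ i x {j} → (i ≢ j → F._≈_ j (x j) (F.0# j)) → F._≈_ j (erase i x j) (F.0# j)
  erase-vanishes i x {j} h with i ≟ j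
  ... | yes _   = F.refl j
  ... | no  i≢j = h i≢j

  -- The standard idempotent of the `i`-th factor.
  unit : Fin n → R.Carrier
  unit i = single i (F.1# i)

  unit-idem : ∀ i → (unit i R.* unit i) R.≈ unit i
  unit-idem i = R.trans (single-* i (F.1# i) (unit i))
    (single-cong i (F.trans i (F.*-identityˡ i _) (single-≡ i (F.1# i))))

  unit≉0 : ∀ {i} → ¬ (unit i R.≈ R.0#)
  unit≉0 {i} e≈0 = F.1≉0 i (F.trans i (F.sym i (single-≡ i (F.1# i))) (e≈0 i))

  -- Supports of ideals, decided by excluded middle

  zero? : ∀ i a → Dec (F._≈_ i a (F.0# i))
  zero? i a = map′ lower lift (em {Lift c (F._≈_ i a (F.0# i))})

  -- Testing the idempotent is equivalent to asking whether some element of `I` is non-zero at `i`,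
  -- because non-zero coordinates can be scaled to 1.
  support : Ideal R → Subset n
  support I = tabulate λ i → does (em {⟦ I ⟧ (unit i)})

  module _ (I : Ideal R) where

    ∈support⁺ : ∀ {i} → ⟦ I ⟧ (unit i) → i ∈ support I
    ∈support⁺ {i} e∈I = lookup⇒[]= i _ (trans (lookup∘tabulate _ i) (dec-true em e∈I))

    ∈support⁻ : ∀ {i} → i ∈ support I → ⟦ I ⟧ (unit i)
    ∈support⁻ {i} i∈ with em {⟦ I ⟧ (unit i)} | trans (sym (lookup∘tabulate _ i)) ([]=⇒lookup i∈)
    ... | yes e∈I | _  = e∈I
    ... | no  _   | ()

    single∈ : ∀ {i} a → i ∈ support I → ⟦ I ⟧ (single i a)
    single∈ {i} a i∈ = respects I
      (R.trans (single-* i a (unit i)) (single-cong i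
        (F.trans i (F.*-congˡ i (single-≡ i (F.1# i))) (F.*-identityʳ i a))))
      (*-absorbs I (single i a) (∈support⁻ i∈))

    -- A non-zero coordinate is invertible in its field, so a multiple of `x` is the idempotent of
    -- that coordinate, which puts `i` in the support.
    vanishes-off-support : ∀ {x} → ⟦ I ⟧ x → ∀ {i} → i ∉ support I → F._≈_ i (x i) (F.0# i)
    vanishes-off-support {x} x∈I {i} i∉ with zero? i (x i)
    ... | yes xᵢ≈0 = xᵢ≈0
    ... | no  xᵢ≉0 = let xᵢ⁻¹ , xᵢ⁻¹xᵢ≈1 , _ = F.invertible i (x i) xᵢ≉0 in
      contradiction (∈support⁺ (respects I
        (R.trans (single-* i xᵢ⁻¹ x) (single-cong i xᵢ⁻¹xᵢ≈1))
        (*-absorbs I (single i xᵢ⁻¹) x∈I))) i∉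

    -- Induction on a list of coordinates outside which `x` vanishes: each step splits `x` into one
    -- coordinate vector in `I` and a remainder that vanishes off the shorter list.
    supported-on⇒∈ : ∀ is {x} → (∀ {i} → i List.∉ is → F._≈_ i (x i) (F.0# i)) →
                     (∀ {i} → i ∉ support I → F._≈_ i (x i) (F.0# i)) → ⟦ I ⟧ x
    supported-on⇒∈ []       on-is _ = respects I (λ i → F.sym i (on-is λ ())) (0∈ I)
    supported-on⇒∈ (i ∷ is) {x} on-is off = respects I (single+erase i x)
      (+-closed I single∈I (supported-on⇒∈ is
        (λ j∉is → erase-vanishes i x λ i≢j → on-is λ
          { (here j≡i) → i≢j (sym j≡i) ; (there j∈is) → j∉is j∈is })
        (λ j∉ → erase-vanishes i x λ _ → off j∉)))
      where
      single∈I : ⟦ I ⟧ (single i (x i))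
      single∈I with i ∈? support I
      ... | yes i∈ = single∈ (x i) i∈
      ... | no  i∉ = respects I
        (R.sym (R.trans (single-cong i (off i∉)) (single-0 i))) (0∈ I)

    vanishes-off-support⇒∈ : ∀ {x} → (∀ {i} → i ∉ support I → F._≈_ i (x i) (F.0# i)) → ⟦ I ⟧ x
    -- With every index listed, vanishing off the list holds vacuously.
    vanishes-off-support⇒∈ = supported-on⇒∈ (allFin n) (λ {i} i∉ → contradiction (∈-allFin i) i∉)

  support-mono : ∀ I J → (∀ {x} → ⟦ I ⟧ x → ⟦ J ⟧ x) → support I ⊆ support J
  support-mono I J I⊆J i∈ = ∈support⁺ J (I⊆J (∈support⁻ I i∈))

  support-reflects-⊆ : ∀ I J → support I ⊆ support J → ∀ {x} → ⟦ I ⟧ x → ⟦ J ⟧ x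
  support-reflects-⊆ I J I⊆J x∈I =
    vanishes-off-support⇒∈ J λ i∉J → vanishes-off-support I x∈I (i∉J ∘ I⊆J)

  NonZero⇒Nonempty-support : ∀ I → NonZeroIdeal R I → Nonempty (support I)
  NonZero⇒Nonempty-support I I≉0 with nonempty? (support I)
  ... | yes ne = ne
  ... | no  none = ⊥-elim (I≉0
    ( (λ x∈I i → vanishes-off-support I x∈I λ i∈ → none (i , i∈))
    , (λ x≈0 → respects I (R.sym x≈0) (0∈ I))))

  Nonempty-support⇒NonZero : ∀ I → Nonempty (support I) → NonZeroIdeal R I
  Nonempty-support⇒NonZero I (i , i∈) I≐0 = unit≉0 {i} (proj₁ I≐0 (∈support⁻ I i∈))

  -- Ideals with prescribed support, annihilators and products

  vanishing : Subset n → Ideal R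
  vanishing S = record
    -- Equations in the factors live at level `ℓ`; `Lift c` raises them to the level that `Ideal`
    -- prescribes.
    { ⟦_⟧       = λ x → Lift c (∀ i → i ∉ S → F._≈_ i (x i) (F.0# i))
    ; respects  = λ x≈y (lift p) → lift λ i i∉ → F.trans i (F.sym i (x≈y i)) (p i i∉)
    ; 0∈        = lift λ i _ → F.refl i
    ; +-closed  = λ (lift p) (lift q) → lift λ i i∉ →
        F.trans i (F.+-cong i (p i i∉) (q i i∉)) (F.+-identityˡ i (F.0# i))
    ; *-absorbs = λ r (lift p) → lift λ i i∉ →
        F.trans i (F.*-congˡ i (p i i∉)) (F.zeroʳ i (r i))
    }

  support-vanishing : ∀ S → support (vanishing S) ≡ S
  support-vanishing S = ⊆-antisym
    (λ {i} i∈ → decidable-stable (i ∈? S) λ i∉S → F.1≉0 i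
      (F.trans i (F.sym i (single-≡ i (F.1# i)))
                 (lower (∈support⁻ (vanishing S) i∈) i i∉S)))
    (λ {i} i∈S → ∈support⁺ (vanishing S) (lift λ j j∉S →
      single-≢ (F.1# i) λ i≡j → j∉S (subst (_∈ S) i≡j i∈S)))

  -- An idempotent in both `I` and its annihilator would equal its own square, which is zero.
  -- Conversely, if `i` is off the support, every element of `I` vanishes at `i` and is killed by
  -- `unit i`.
  support-Ann : ∀ I → support (Ann R I) ≡ ∁ (support I)
  support-Ann I = ⊆-antisym
    (λ {i} i∈Ann → x∉p⇒x∈∁p λ i∈I → unit≉0 {i}
      (R.trans (R.sym (unit-idem i)) (∈support⁻ (Ann R I) i∈Ann (unit i) (∈support⁻ I i∈I))))
    (λ {i} i∈∁ → ∈support⁺ (Ann R I) λ x x∈I →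
      R.trans (single-* i (F.1# i) x)
        (R.trans (single-cong i (F.trans i (F.*-identityˡ i (x i))
                    (vanishes-off-support I x∈I (x∈∁p⇒x∉p i∈∁))))
                 (single-0 i)))

  product⊆∩ : ∀ I J {z} → _∈Product_,_ R z I J → ⟦ I ⟧ z × ⟦ J ⟧ z
  product⊆∩ I J (empty z≈0) = respects I (R.sym z≈0) (0∈ I) , respects J (R.sym z≈0) (0∈ J)
  product⊆∩ I J (term {x} {y} x∈I y∈J w∈ z≈xy+w) = let w∈I , w∈J = product⊆∩ I J w∈ in
    respects I (R.sym z≈xy+w) (+-closed I (respects I (R.*-comm y x) (*-absorbs I y x∈I)) w∈I) ,
    respects J (R.sym z≈xy+w) (+-closed J (*-absorbs J x y∈J) w∈J)

  support-· : ∀ I J → support (_·_ R I J) ≡ support I ∩ support J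
  support-· I J = ⊆-antisym
    (λ i∈IJ → let e∈I , e∈J = product⊆∩ I J (∈support⁻ (_·_ R I J) i∈IJ) in
      x∈p∩q⁺ (∈support⁺ I e∈I , ∈support⁺ J e∈J))
    (λ {i} i∈ → let i∈I , i∈J = x∈p∩q⁻ (support I) (support J) i∈ in
      -- The idempotent is its own square, hence a single product term with one factor from each
      -- ideal.
      ∈support⁺ (_·_ R I J) (term (∈support⁻ I i∈I) (∈support⁻ J i∈J) (empty R.refl)
        (R.sym (R.trans (R.+-identityʳ _) (unit-idem i)))))

  -- Essential ideals and adjacency

  Essential⇒∈support : ∀ K → Essential R K → ∀ i → i ∈ support K
  Essential⇒∈support K (_ , meets) i = subst (_∈ support K) j≡i j∈K
    where
    -- The test ideal consists of the vectors supported at `i`. An essential `K` meets it, and the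
    -- intersection can have no support other than `i`.
    ⟨i⟩ : Ideal R
    ⟨i⟩ = vanishing ⁅ i ⁆
    supp⟨i⟩ : support ⟨i⟩ ≡ ⁅ i ⁆
    supp⟨i⟩ = support-vanishing ⁅ i ⁆

    K∩⟨i⟩≠0 : NonZeroIdeal R (_∩ᴵ_ R K ⟨i⟩)
    K∩⟨i⟩≠0 = meets ⟨i⟩ (Nonempty-support⇒NonZero ⟨i⟩
                (i , subst (i ∈_) (sym supp⟨i⟩) (x∈⁅x⁆ i)))

    j : Fin n
    j = proj₁ (NonZero⇒Nonempty-support (_∩ᴵ_ R K ⟨i⟩) K∩⟨i⟩≠0)

    j∈ : j ∈ support (_∩ᴵ_ R K ⟨i⟩)
    j∈ = proj₂ (NonZero⇒Nonempty-support (_∩ᴵ_ R K ⟨i⟩) K∩⟨i⟩≠0)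

    j∈K : j ∈ support K
    j∈K = support-mono (_∩ᴵ_ R K ⟨i⟩) K proj₁ j∈

    j≡i : j ≡ i
    j≡i = x∈⁅y⁆⇒x≡y i (subst (j ∈_) supp⟨i⟩
      (support-mono (_∩ᴵ_ R K ⟨i⟩) ⟨i⟩ proj₂ j∈))

  -- Any non-zero `J` contains some idempotent, which `K` contains as well. The index `i₀` ensures
  -- that `K` itself is non-zero.
  ∈support⇒Essential : Fin n → ∀ K → (∀ i → i ∈ support K) → Essential R K
  ∈support⇒Essential i₀ K full =
    Nonempty-support⇒NonZero K (i₀ , full i₀) ,
    λ J J≉0 → let i , i∈J = NonZero⇒Nonempty-support J J≉0 in
      Nonempty-support⇒NonZero (_∩ᴵ_ R K J)
        (i , ∈support⁺ (_∩ᴵ_ R K J) (∈support⁻ K (full i) , ∈support⁻ J i∈J))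

  support-Ann-· : ∀ I J → support (Ann R (_·_ R I J)) ≡ ∁ (support I ∩ support J)
  support-Ann-· I J = trans (support-Ann (_·_ R I J)) (cong ∁ (support-· I J))

  EG-isDisjointnessGraph : Fin n → IsDisjointnessGraph n (EG R)
  EG-isDisjointnessGraph i₀ = record
    { support           = λ u → support (ideal u)
    ; support-cong      = λ {u} {w} (u⊆w , w⊆u) → ⊆-antisym
        (support-mono (ideal u) (ideal w) u⊆w) (support-mono (ideal w) (ideal u) w⊆u)
    ; support-injective = λ {u} {w} u≡w →
        support-reflects-⊆ (ideal u) (ideal w) (λ {i} → subst (i ∈_) u≡w) ,
        support-reflects-⊆ (ideal w) (ideal u) (λ {i} → subst (i ∈_) (sym u≡w))
    ; support-nonempty  = λ u → NonZero⇒Nonempty-support (ideal u) (nonZero u)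
    ; vertex            = λ S S≠∅ ∁S≠∅ → record
        { ideal       = vanishing S
        ; nonZero     = Nonempty-support⇒NonZero (vanishing S)
            (subst Nonempty (sym (support-vanishing S)) S≠∅)
        ; nonZero-Ann = Nonempty-support⇒NonZero (Ann R (vanishing S))
            (subst Nonempty (sym (trans (support-Ann (vanishing S))
                                        (cong ∁ (support-vanishing S)))) ∁S≠∅)
        }
    ; support-vertex    = λ S _ _ → support-vanishing S
    -- Essentiality of `Ann (IJ)` puts every index in the complement of the intersection of the two
    -- supports.
    ; Adj⇒Disjoint      = λ {u} {w} (_ , essential) (i , i∈) →
        x∈p⇒x∉∁p i∈ (subst (i ∈_) (support-Ann-· (ideal u) (ideal w))
          (Essential⇒∈support (Ann R (_·_ R (ideal u) (ideal w))) essential i))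
    ; Disjoint⇒Adj      = λ {u} {w} u∩w=∅ →
        -- Equal ideals would have supports that are equal, nonempty and disjoint.
        (λ (u⊆w , _) → let i , i∈u = NonZero⇒Nonempty-support (ideal u) (nonZero u) in
          Disjoint⇒∉ u∩w=∅ i∈u (support-mono (ideal u) (ideal w) u⊆w i∈u)) ,
        ∈support⇒Essential i₀ (Ann R (_·_ R (ideal u) (ideal w))) λ i →
          subst (i ∈_) (sym (support-Ann-· (ideal u) (ideal w)))
            (x∉p⇒x∈∁p λ i∈ → u∩w=∅ (i , i∈))
    }
    where open AnnihilatingIdeal

theorem2p5 : ∀ {c ℓ : Level} → ExcludedMiddle (c ⊔ ℓ) →
    (n : ℕ) → 2 ≤ n → (F : Fin n → Field c ℓ) →
    Class1 (EG (Π (λ i → Field.commutativeRing (F i))))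
theorem2p5 em (ℕ.suc (ℕ.suc m)) (s≤s (s≤s z≤n)) F =
  disjointness⇒Class1 (EG-isDisjointnessGraph em F zero)
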